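{- Let $\mathcal{I}$ be a small category, let $\iota\colon\mathcal{O}\hookrightarrow\mathcal{I}$ be the inclusion of a full subcategory, let $\mathcal{C}$ be a category and let $\mathcal{L}\colon\mathcal{O}\to\mathcal{C}$ be a functor. If the left Kan extension $\mathrm{Lan}_{\iota}\mathcal{L}$ of $\mathcal{L}$ along $\iota$ exists, then it is an initial object of $\mathsf{Auto}(\mathcal{L})$; that is, an initial object $\mathcal{A}^{\mathit{init}}(\mathcal{L})$ of $\mathsf{Auto}(\mathcal{L})$ exists and is isomorphic (as a functor $\mathcal{I}\to\mathcal{C}$) to $\mathrm{Lan}_{\iota}\mathcal{L}$. Dually, if the right Kan extension $\mathrm{Ran}_{\iota}\mathcal{L}$ of $\mathcal{L}$ along $\iota$ exists, then a final (terminal) object $\mathcal{A}^{\mathit{final}}(\mathcal{L})$ of $\mathsf{Auto}(\mathcal{L})$ exists and is isomorphic to $\mathrm{Ran}_{\iota}\mathcal{L}$.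
   Context: A functor $\mathcal{A}\colon\mathcal{I}\to\mathcal{C}$ (a $\mathcal{C}$-automaton) accepts the functor $\mathcal{L}\colon\mathcal{O}\to\mathcal{C}$ (a $\mathcal{C}$-language) when $\mathcal{A}\circ\iota=\mathcal{L}$. The category $\mathsf{Auto}(\mathcal{L})$ is the subcategory of the functor category $[\mathcal{I},\mathcal{C}]$ whose objects are the functors $\mathcal{A}$ with $\mathcal{A}\circ\iota=\mathcal{L}$ (strict equality) and whose arrows $\mathcal{A}\to\mathcal{B}$ are the natural transformations $\alpha\colon\mathcal{A}\to\mathcal{B}$ with $\alpha\circ\iota=\mathrm{id}_{\mathcal{L}}$. Kan extensions are understood up to isomorphism: since $\iota$ is full and faithful, the restriction of a Kan extension along $\iota$ is canonically isomorphic to $\mathcal{L}$, and one replaces the Kan extension by an isomorphic functor restricting strictly to $\mathcal{L}$ (with unit, respectively counit, the identity) when regarding it as an object of $\mathsf{Auto}(\mathcal{L})$.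
   Formalization: The Kan extension is also assumed pointwise at the objects of O (equivalently, its unit or counit is invertible), since without this Auto(L) can be empty although Lan exists; membership of an object of I in O is assumed decidable, which excluded middle supplies. -}

module Defs where

open import Level using (Level; _⊔_; suc)
open import Data.Product using (Σ; Σ-syntax; _×_; _,_; proj₁; proj₂)
open import Data.Refinement using (Refinement; value)
open import Relation.Binary using (Rel; IsEquivalence; Setoid)
open import Relation.Binary.PropositionalEquality as ≡ using (_≡_; subst₂)
import Relation.Binary.Reasoning.Setoid as SetoidReasoning

-- Objects are compared with _≡_; each hom-set is a setoid.
record Category (o ℓ e : Level) : Set (suc (o ⊔ ℓ ⊔ e)) where
  infix  4 _≈_ _⇒_
  infixr 9 _∘_
  field
    Obj : Set o
    _⇒_ : Rel Obj ℓ
    _≈_ : ∀ {X Y} → Rel (X ⇒ Y) e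
    id  : ∀ {X} → X ⇒ X
    _∘_ : ∀ {X Y Z} → Y ⇒ Z → X ⇒ Y → X ⇒ Z
    equiv     : ∀ {X Y} → IsEquivalence (_≈_ {X} {Y})
    assoc     : ∀ {W X Y Z} {f : W ⇒ X} {g : X ⇒ Y} {h : Y ⇒ Z} →
                (h ∘ g) ∘ f ≈ h ∘ (g ∘ f)
    identityˡ : ∀ {X Y} {f : X ⇒ Y} → id ∘ f ≈ f
    identityʳ : ∀ {X Y} {f : X ⇒ Y} → f ∘ id ≈ f
    ∘-resp-≈  : ∀ {X Y Z} {f h : Y ⇒ Z} {g i : X ⇒ Y} →
                f ≈ h → g ≈ i → f ∘ g ≈ h ∘ i

  module Equiv {X Y : Obj} = IsEquivalence (equiv {X} {Y})

  hom-setoid : Obj → Obj → Setoid ℓ e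
  hom-setoid X Y = record { Carrier = X ⇒ Y ; _≈_ = _≈_ ; isEquivalence = equiv }

record Functor {o ℓ e o′ ℓ′ e′ : Level}
               (C : Category o ℓ e) (D : Category o′ ℓ′ e′)
               : Set (o ⊔ ℓ ⊔ e ⊔ o′ ⊔ ℓ′ ⊔ e′) where
  private
    module C = Category C
    module D = Category D
  field
    F₀ : C.Obj → D.Obj
    F₁ : ∀ {X Y} → X C.⇒ Y → F₀ X D.⇒ F₀ Y
    identity     : ∀ {X} → F₁ (C.id {X}) D.≈ D.id
    homomorphism : ∀ {X Y Z} {f : X C.⇒ Y} {g : Y C.⇒ Z} →
                   F₁ (g C.∘ f) D.≈ F₁ g D.∘ F₁ f
    F-resp-≈     : ∀ {X Y} {f g : X C.⇒ Y} → f C.≈ g → F₁ f D.≈ F₁ g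

open Functor public using (F₀; F₁)

private
  variable
    o₁ ℓ₁ e₁ o₂ ℓ₂ e₂ o₃ ℓ₃ e₃ p : Level

infixr 9 _∘F_
_∘F_ : {A : Category o₁ ℓ₁ e₁} {B : Category o₂ ℓ₂ e₂} {C : Category o₃ ℓ₃ e₃} →
       Functor B C → Functor A B → Functor A C
_∘F_ {C = C} G F = record
  { F₀ = λ X → G.F₀ (F.F₀ X)
  ; F₁ = λ f → G.F₁ (F.F₁ f)
  ; identity     = trans (G.F-resp-≈ F.identity) G.identity
  ; homomorphism = trans (G.F-resp-≈ F.homomorphism) G.homomorphism
  ; F-resp-≈     = λ f≈g → G.F-resp-≈ (F.F-resp-≈ f≈g)
  }
  where
  module F = Functor F
  module G = Functor G
  open Category.Equiv C

record NaturalTransformation {C : Category o₁ ℓ₁ e₁} {D : Category o₂ ℓ₂ e₂}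
                             (F G : Functor C D)
                             : Set (o₁ ⊔ ℓ₁ ⊔ e₁ ⊔ o₂ ⊔ ℓ₂ ⊔ e₂) where
  private
    module C = Category C
    module D = Category D
  field
    η       : ∀ X → F₀ F X D.⇒ F₀ G X
    commute : ∀ {X Y} (f : X C.⇒ Y) → η Y D.∘ F₁ F f D.≈ F₁ G f D.∘ η X

open NaturalTransformation public using (η)

[_,_] : Category o₁ ℓ₁ e₁ → Category o₂ ℓ₂ e₂ →
        Category (o₁ ⊔ ℓ₁ ⊔ e₁ ⊔ o₂ ⊔ ℓ₂ ⊔ e₂) (o₁ ⊔ ℓ₁ ⊔ e₁ ⊔ o₂ ⊔ ℓ₂ ⊔ e₂) (o₁ ⊔ e₂)
[ C , D ] = record
  { Obj = Functor C D
  ; _⇒_ = NaturalTransformation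
  ; _≈_ = λ α β → ∀ X → η α X D.≈ η β X
  ; id  = record { η = λ _ → D.id ; commute = λ _ → trans D.identityˡ (sym D.identityʳ) }
  ; _∘_ = λ {F} {G} {H} β α → record
      { η = λ X → η β X D.∘ η α X
      ; commute = λ {X} {Y} f → let open SetoidReasoning (D.hom-setoid (F₀ F X) (F₀ H Y)) in begin
          (η β Y D.∘ η α Y) D.∘ F₁ F f  ≈⟨ D.assoc ⟩
          η β Y D.∘ (η α Y D.∘ F₁ F f)  ≈⟨ D.∘-resp-≈ refl (NaturalTransformation.commute α f) ⟩
          η β Y D.∘ (F₁ G f D.∘ η α X)  ≈⟨ D.assoc ⟨
          (η β Y D.∘ F₁ G f) D.∘ η α X  ≈⟨ D.∘-resp-≈ (NaturalTransformation.commute β f) refl ⟩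
          (F₁ H f D.∘ η β X) D.∘ η α X  ≈⟨ D.assoc ⟩
          F₁ H f D.∘ (η β X D.∘ η α X)  ∎
      }
  ; equiv = record
      { refl  = λ _ → refl
      ; sym   = λ α≈β X → sym (α≈β X)
      ; trans = λ α≈β β≈γ X → trans (α≈β X) (β≈γ X)
      }
  ; assoc     = λ _ → D.assoc
  ; identityˡ = λ _ → D.identityˡ
  ; identityʳ = λ _ → D.identityʳ
  ; ∘-resp-≈  = λ α≈β γ≈δ X → D.∘-resp-≈ (α≈β X) (γ≈δ X)
  }
  where
  module D = Category D
  open D.Equiv

infixl 9 _∘ʳ_
_∘ʳ_ : {A : Category o₁ ℓ₁ e₁} {B : Category o₂ ℓ₂ e₂} {C : Category o₃ ℓ₃ e₃} {F G : Functor B C} →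
       NaturalTransformation F G → (K : Functor A B) → NaturalTransformation (F ∘F K) (G ∘F K)
α ∘ʳ K = record
  { η       = λ X → η α (F₀ K X)
  ; commute = λ f → NaturalTransformation.commute α (F₁ K f)
  }

module _ (C : Category o₁ ℓ₁ e₁) where
  open Category C

  IsInitial : Obj → Set (o₁ ⊔ ℓ₁ ⊔ e₁)
  IsInitial X = ∀ Y → Σ[ f ∈ X ⇒ Y ] (∀ g → g ≈ f)

  IsTerminal : Obj → Set (o₁ ⊔ ℓ₁ ⊔ e₁)
  IsTerminal X = ∀ Y → Σ[ f ∈ Y ⇒ X ] (∀ g → g ≈ f)

  record Iso (X Y : Obj) : Set (ℓ₁ ⊔ e₁) where
    field
      to   : X ⇒ Y
      from : Y ⇒ X
      isoˡ : from ∘ to ≈ id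
      isoʳ : to ∘ from ≈ id

-- Refinement makes the membership proof irrelevant, so that the objects form a
-- genuine subset of those of C even if P is not proposition-valued.
FullSubcategory : (C : Category o₁ ℓ₁ e₁) → (Category.Obj C → Set p) → Category (o₁ ⊔ p) ℓ₁ e₁
FullSubcategory C P = record
  { Obj = Refinement C.Obj P
  ; _⇒_ = λ X Y → value X C.⇒ value Y
  ; _≈_ = C._≈_
  ; id  = C.id
  ; _∘_ = C._∘_
  ; equiv     = C.equiv
  ; assoc     = C.assoc
  ; identityˡ = C.identityˡ
  ; identityʳ = C.identityʳ
  ; ∘-resp-≈  = C.∘-resp-≈
  }
  where module C = Category C

inclusion : (C : Category o₁ ℓ₁ e₁) (P : Category.Obj C → Set p) → Functor (FullSubcategory C P) C
inclusion C P = record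
  { F₀ = value
  ; F₁ = λ f → f
  ; identity     = refl
  ; homomorphism = refl
  ; F-resp-≈     = λ f≈g → f≈g
  }
  where open Category.Equiv C

-- Strict equality of functors: equal on objects, and equal on arrows once the
-- endpoints have been identified.
record _≡F_ {C : Category o₁ ℓ₁ e₁} {D : Category o₂ ℓ₂ e₂} (F G : Functor C D)
            : Set (o₁ ⊔ ℓ₁ ⊔ o₂ ⊔ e₂) where
  private
    module C = Category C
    module D = Category D
  field
    eq₀ : ∀ X → F₀ F X ≡ F₀ G X
    eq₁ : ∀ {X Y} (f : X C.⇒ Y) → subst₂ D._⇒_ (eq₀ X) (eq₀ Y) (F₁ F f) D.≈ F₁ G f

open _≡F_ public using (eq₀)

module _ {O : Category o₁ ℓ₁ e₁} {I : Category o₂ ℓ₂ e₂} {C : Category o₃ ℓ₃ e₃} where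
  private
    module O = Category O
    module I = Category I
    module C = Category C

  -- For α : F → G, with F = L and G = L strictly, the equation α = id_L.
  IsIdentityOn : (L : Functor O C) {F G : Functor O C} → F ≡F L → G ≡F L →
                 NaturalTransformation F G → Set (o₁ ⊔ e₃)
  IsIdentityOn L F≡L G≡L α =
    ∀ X → subst₂ C._⇒_ (eq₀ F≡L X) (eq₀ G≡L X) (η α X) C.≈ C.id {F₀ L X}

  private
    subst₂-id : ∀ {X Y} (p : X ≡ Y) → subst₂ C._⇒_ p p C.id C.≈ C.id
    subst₂-id ≡.refl = C.Equiv.refl

    subst₂-∘ : ∀ {X Y Z X′ Y′ Z′} (p : X ≡ X′) (q : Y ≡ Y′) (r : Z ≡ Z′)
               (g : Y C.⇒ Z) (f : X C.⇒ Y) →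
               subst₂ C._⇒_ p r (g C.∘ f) C.≈ subst₂ C._⇒_ q r g C.∘ subst₂ C._⇒_ p q f
    subst₂-∘ ≡.refl ≡.refl ≡.refl g f = C.Equiv.refl

  -- An object carries its proof of A ∘ ι = L, and arrows refer to the component
  -- eq₀ of that proof.  If Obj C satisfies UIP, eq₀ is unique and this is the usual
  -- subcategory of [ I , C ]; no such assumption is made on C.
  Auto : Functor O I → Functor O C →
         Category (o₁ ⊔ ℓ₁ ⊔ o₂ ⊔ ℓ₂ ⊔ e₂ ⊔ o₃ ⊔ ℓ₃ ⊔ e₃)
                  (o₁ ⊔ o₂ ⊔ ℓ₂ ⊔ e₂ ⊔ o₃ ⊔ ℓ₃ ⊔ e₃) (o₂ ⊔ e₃)
  Auto ι L = record
    { Obj = Σ[ A ∈ Functor I C ] (A ∘F ι) ≡F L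
    ; _⇒_ = λ (A , A∘ι≡L) (B , B∘ι≡L) →
        Σ[ α ∈ NaturalTransformation A B ] IsIdentityOn L A∘ι≡L B∘ι≡L (α ∘ʳ ι)
    ; _≈_ = λ α β → proj₁ α IC.≈ proj₁ β
    ; id  = λ { {_ , A≡} → IC.id , λ X → subst₂-id (eq₀ A≡ X) }
    ; _∘_ = λ { {_ , A≡} {_ , B≡} {_ , C≡} (β , β-id) (α , α-id) →
        β IC.∘ α , λ X → trans (subst₂-∘ (eq₀ A≡ X) (eq₀ B≡ X) (eq₀ C≡ X) _ _)
                               (trans (C.∘-resp-≈ (β-id X) (α-id X)) C.identityˡ) }
    ; equiv = record
        { refl  = λ _ → refl
        ; sym   = λ α≈β X → sym (α≈β X)
        ; trans = λ α≈β β≈γ X → trans (α≈β X) (β≈γ X)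
        }
    ; assoc     = λ _ → C.assoc
    ; identityˡ = λ _ → C.identityˡ
    ; identityʳ = λ _ → C.identityʳ
    ; ∘-resp-≈  = λ α≈β γ≈δ X → C.∘-resp-≈ (α≈β X) (γ≈δ X)
    }
    where
    module IC = Category [ I , C ]
    open C.Equiv

  record LeftKanExtension (ι : Functor O I) (L : Functor O C)
                          : Set (o₁ ⊔ ℓ₁ ⊔ e₁ ⊔ o₂ ⊔ ℓ₂ ⊔ e₂ ⊔ o₃ ⊔ ℓ₃ ⊔ e₃) where
    field
      Lan    : Functor I C
      unit   : NaturalTransformation L (Lan ∘F ι)
      σ      : (M : Functor I C) → NaturalTransformation L (M ∘F ι) → NaturalTransformation Lan M
      σ-comm : (M : Functor I C) (γ : NaturalTransformation L (M ∘F ι)) →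
               ∀ X → η (σ M γ ∘ʳ ι) X C.∘ η unit X C.≈ η γ X
      σ-unique : (M : Functor I C) (γ : NaturalTransformation L (M ∘F ι))
                 (τ : NaturalTransformation Lan M) →
                 (∀ X → η (τ ∘ʳ ι) X C.∘ η unit X C.≈ η γ X) →
                 ∀ Y → η τ Y C.≈ η (σ M γ) Y

  record RightKanExtension (ι : Functor O I) (L : Functor O C)
                           : Set (o₁ ⊔ ℓ₁ ⊔ e₁ ⊔ o₂ ⊔ ℓ₂ ⊔ e₂ ⊔ o₃ ⊔ ℓ₃ ⊔ e₃) where
    field
      Ran    : Functor I C
      counit : NaturalTransformation (Ran ∘F ι) L
      δ      : (M : Functor I C) → NaturalTransformation (M ∘F ι) L → NaturalTransformation M Ran
      δ-comm : (M : Functor I C) (γ : NaturalTransformation (M ∘F ι) L) →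
               ∀ X → η counit X C.∘ η (δ M γ ∘ʳ ι) X C.≈ η γ X
      δ-unique : (M : Functor I C) (γ : NaturalTransformation (M ∘F ι) L)
                 (τ : NaturalTransformation M Ran) →
                 (∀ X → η counit X C.∘ η (τ ∘ʳ ι) X C.≈ η γ X) →
                 ∀ Y → η τ Y C.≈ η (δ M γ) Y

  -- A cocone with apex Z on  (ι ↓ i) → O → C,  where the second functor is L.
  -- The indices (X , f) are the objects of the comma category.  Taking g = id in
  -- `natural` shows that the legs respect the equality of arrows.
  record Cocone (ι : Functor O I) (L : Functor O C) (i : I.Obj) (Z : C.Obj)
                : Set (o₁ ⊔ ℓ₁ ⊔ ℓ₂ ⊔ e₂ ⊔ ℓ₃ ⊔ e₃) where
    field
      leg     : ∀ X → F₀ ι X I.⇒ i → F₀ L X C.⇒ Z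
      natural : ∀ {X Y} (g : X O.⇒ Y) (f : F₀ ι X I.⇒ i) (f′ : F₀ ι Y I.⇒ i) →
                f′ I.∘ F₁ ι g I.≈ f → leg Y f′ C.∘ F₁ L g C.≈ leg X f

  record Cone (ι : Functor O I) (L : Functor O C) (i : I.Obj) (Z : C.Obj)
              : Set (o₁ ⊔ ℓ₁ ⊔ ℓ₂ ⊔ e₂ ⊔ ℓ₃ ⊔ e₃) where
    field
      leg     : ∀ X → i I.⇒ F₀ ι X → Z C.⇒ F₀ L X
      natural : ∀ {X Y} (g : X O.⇒ Y) (f : i I.⇒ F₀ ι X) (f′ : i I.⇒ F₀ ι Y) →
                F₁ ι g I.∘ f I.≈ f′ → F₁ L g C.∘ leg X f C.≈ leg Y f′

  -- Along a fully faithful ι, being pointwise at the objects ι X is equivalent to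
  -- the unit being invertible.  A Kan extension with only the global universal
  -- property can fail this: let O = {x₁,x₂ < y₁,y₂}, I = O plus a point z with
  -- xᵢ < z < yⱼ, and C the poset generated by
  --   a₁,a₂ < b₁,b₂,c    b₁,c < b₁′    b₂,c < b₂′,
  -- with L xᵢ = aᵢ, L yᵢ = bᵢ.  The left Kan extension exists, with Lan xᵢ = aᵢ,
  -- Lan z = c and Lan yᵢ = bᵢ′, although no functor on I restricts to L.

  -- Lan i is the colimit of L over ι ↓ i, through the cocone induced by the unit.
  IsPointwiseLanAt : {ι : Functor O I} {L : Functor O C} → LeftKanExtension ι L →
                     I.Obj → Set (o₁ ⊔ ℓ₁ ⊔ ℓ₂ ⊔ e₂ ⊔ o₃ ⊔ ℓ₃ ⊔ e₃)
  IsPointwiseLanAt {ι} {L} K i = ∀ {Z} (ψ : Cocone ι L i Z) →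
    Σ[ h ∈ F₀ Lan i C.⇒ Z ] Factors ψ h × (∀ h′ → Factors ψ h′ → h′ C.≈ h)
    where
    open LeftKanExtension K
    Factors : ∀ {Z} → Cocone ι L i Z → F₀ Lan i C.⇒ Z → Set (o₁ ⊔ ℓ₂ ⊔ e₃)
    Factors ψ h = ∀ X f → h C.∘ (F₁ Lan f C.∘ η unit X) C.≈ Cocone.leg ψ X f

  IsPointwiseRanAt : {ι : Functor O I} {L : Functor O C} → RightKanExtension ι L →
                     I.Obj → Set (o₁ ⊔ ℓ₁ ⊔ ℓ₂ ⊔ e₂ ⊔ o₃ ⊔ ℓ₃ ⊔ e₃)
  IsPointwiseRanAt {ι} {L} K i = ∀ {Z} (ψ : Cone ι L i Z) →
    Σ[ h ∈ Z C.⇒ F₀ Ran i ] Factors ψ h × (∀ h′ → Factors ψ h′ → h′ C.≈ h)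
    where
    open RightKanExtension K
    Factors : ∀ {Z} → Cone ι L i Z → Z C.⇒ F₀ Ran i → Set (o₁ ⊔ ℓ₂ ⊔ e₃)
    Factors ψ h = ∀ X f → (η counit X C.∘ F₁ Ran f) C.∘ h C.≈ Cone.leg ψ X f

{-# OPTIONS --safe #-}

-- For X in O the identity of ι X is a terminal object of ι ↓ ι X, so L X is the
-- colimit there and the pointwise hypothesis makes the unit invertible.  A functor G
-- with G ∘ ι ≅ L is then replaced by an isomorphic A with A ∘ ι = L on the nose,
-- setting A i = L i if i lies in O and A i = G i otherwise, and conjugating the
-- arrows of G.  For G = Lan, an arrow A → B in Auto L amounts to a transformation
-- Lan → B extending L = B ∘ ι, and there is exactly one by the universal property;
-- dually for Ran.
module Submission where

open import Defs
open import Level using (Level)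
open import Data.Irrelevant using () renaming ([_] to irr)
open import Data.Product using (Σ-syntax; _×_; _,_; proj₁; proj₂)
open import Data.Refinement using (value) renaming (_,_ to _,ᴿ_)
open import Relation.Binary.PropositionalEquality using (_≡_; refl; subst₂)
open import Relation.Nullary using (Dec; yes; no)
open import Relation.Nullary.Negation.Core using (contradiction-irr)
open import Relation.Unary using (Decidable)
import Relation.Binary.Reasoning.Setoid as SetoidReasoning

private
  variable
    o₁ ℓ₁ e₁ o₂ ℓ₂ e₂ p : Level

-- Composition calculus and casts along equalities of objects.

module CategoryProperties (C : Category o₁ ℓ₁ e₁) where
  open Category C
  open Equiv using () renaming (refl to ≈-refl; sym to ≈-sym; trans to ≈-trans)

  module HomReasoning {X Y : Obj} = SetoidReasoning (hom-setoid X Y)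

  ∘-congˡ : ∀ {X Y Z} {g : Y ⇒ Z} {f f′ : X ⇒ Y} → f ≈ f′ → g ∘ f ≈ g ∘ f′
  ∘-congˡ = ∘-resp-≈ ≈-refl

  ∘-congʳ : ∀ {X Y Z} {g g′ : Y ⇒ Z} {f : X ⇒ Y} → g ≈ g′ → g ∘ f ≈ g′ ∘ f
  ∘-congʳ g≈g′ = ∘-resp-≈ g≈g′ ≈-refl

  pullˡ : ∀ {W X Y Z} {h : Y ⇒ Z} {g : X ⇒ Y} {k : X ⇒ Z} {f : W ⇒ X} →
          h ∘ g ≈ k → h ∘ (g ∘ f) ≈ k ∘ f
  pullˡ hg≈k = ≈-trans (≈-sym assoc) (∘-congʳ hg≈k)

  pullʳ : ∀ {W X Y Z} {h : Y ⇒ Z} {g : X ⇒ Y} {f : W ⇒ X} {k : W ⇒ Y} →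
          g ∘ f ≈ k → (h ∘ g) ∘ f ≈ h ∘ k
  pullʳ gf≈k = ≈-trans assoc (∘-congˡ gf≈k)

  cancelˡ : ∀ {X Y Z} {h : Y ⇒ Z} {g : Z ⇒ Y} {f : X ⇒ Z} → h ∘ g ≈ id → h ∘ (g ∘ f) ≈ f
  cancelˡ hg≈id = ≈-trans (pullˡ hg≈id) identityˡ

  cancelʳ : ∀ {X Y Z} {h : Y ⇒ Z} {g : X ⇒ Y} {f : Y ⇒ X} → g ∘ f ≈ id → (h ∘ g) ∘ f ≈ h
  cancelʳ gf≈id = ≈-trans (pullʳ gf≈id) identityʳ

  Iso-refl : ∀ {X} → Iso C X X
  Iso-refl = record { to = id ; from = id ; isoˡ = identityˡ ; isoʳ = identityˡ }

  Iso-sym : ∀ {X Y} → Iso C X Y → Iso C Y X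
  Iso-sym i = record { to = from ; from = to ; isoˡ = isoʳ ; isoʳ = isoˡ }
    where open Iso i

  ≡⇒Iso : ∀ {X Y} → X ≡ Y → Iso C X Y
  ≡⇒Iso refl = Iso-refl

  cast : ∀ {X Y} → X ≡ Y → X ⇒ Y
  cast X≡Y = Iso.to (≡⇒Iso X≡Y)

  -- With `square⇒subst₂`, this trades transport of arrows for commuting squares, so that strict
  -- equality can be handled by composition alone.
  subst₂⇒square : ∀ {X Y X′ Y′} (q : X ≡ X′) (r : Y ≡ Y′) {f : X ⇒ Y} {g : X′ ⇒ Y′} →
                  subst₂ _⇒_ q r f ≈ g → cast r ∘ f ≈ g ∘ cast q
  subst₂⇒square refl refl f≈g = ≈-trans identityˡ (≈-trans f≈g (≈-sym identityʳ))

  square⇒subst₂ : ∀ {X Y X′ Y′} (q : X ≡ X′) (r : Y ≡ Y′) {f : X ⇒ Y} {g : X′ ⇒ Y′} →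
                  cast r ∘ f ≈ g ∘ cast q → subst₂ _⇒_ q r f ≈ g
  square⇒subst₂ refl refl sq = ≈-trans (≈-sym identityˡ) (≈-trans sq identityʳ)

-- Natural isomorphisms and conjugation of a functor.

module _ {B : Category o₁ ℓ₁ e₁} {C : Category o₂ ℓ₂ e₂} where
  private module B = Category B
  open Category C
  open CategoryProperties C

  -- Naturality of the inverses is automatic: insert `η α X ∘ inv X`, move `α` across by its own
  -- naturality, and cancel.
  pointwiseIso : {F G : Functor B C} (α : NaturalTransformation F G) (inv : ∀ X → F₀ G X ⇒ F₀ F X) →
                 (∀ X → inv X ∘ η α X ≈ id) → (∀ X → η α X ∘ inv X ≈ id) → Iso [ B , C ] F G
  pointwiseIso {F} {G} α inv invˡ invʳ = record
    { to   = α
    ; from = record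
        { η       = inv
        ; commute = λ {X} {Y} f → begin
            inv Y ∘ F₁ G f                      ≈⟨ ∘-congˡ (cancelʳ (invʳ X)) ⟨
            inv Y ∘ ((F₁ G f ∘ η α X) ∘ inv X)  ≈⟨ ∘-congˡ (∘-congʳ (NaturalTransformation.commute α f)) ⟨
            inv Y ∘ ((η α Y ∘ F₁ F f) ∘ inv X)  ≈⟨ ∘-congˡ assoc ⟩
            inv Y ∘ (η α Y ∘ (F₁ F f ∘ inv X))  ≈⟨ cancelˡ (invˡ Y) ⟩
            F₁ F f ∘ inv X                      ∎
        }
    ; isoˡ = invˡ
    ; isoʳ = invʳ
    }
    where open HomReasoning

  -- The equation `eq₁`, read as a square, is exactly naturality of the casts along `eq₀`.
  ≡F⇒Iso : {F G : Functor B C} → F ≡F G → Iso [ B , C ] F G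
  ≡F⇒Iso F≡G = pointwiseIso
    (record
      { η       = λ X → cast (eq₀ F≡G X)
      ; commute = λ {X} {Y} f → subst₂⇒square (eq₀ F≡G X) (eq₀ F≡G Y) (_≡F_.eq₁ F≡G f)
      })
    (λ X → Iso.from (≡⇒Iso (eq₀ F≡G X)))
    (λ X → Iso.isoˡ (≡⇒Iso (eq₀ F≡G X)))
    (λ X → Iso.isoʳ (≡⇒Iso (eq₀ F≡G X)))

  module Conjugate (G : Functor B C) {A₀ : B.Obj → Obj} (φ : ∀ X → Iso C (A₀ X) (F₀ G X)) where
    private
      module G = Functor G
      module φ X = Iso (φ X)

    functor : Functor B C
    functor = record
      { F₀ = A₀
      ; F₁ = λ {X} {Y} f → φ.from Y ∘ (F₁ G f ∘ φ.to X)
      ; identity = λ {X} → begin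
          φ.from X ∘ (F₁ G B.id ∘ φ.to X)  ≈⟨ ∘-congˡ (∘-congʳ G.identity) ⟩
          φ.from X ∘ (id ∘ φ.to X)         ≈⟨ ∘-congˡ identityˡ ⟩
          φ.from X ∘ φ.to X                ≈⟨ φ.isoˡ X ⟩
          id                               ∎
      ; homomorphism = λ {X} {Y} {Z} {f} {g} → begin
          φ.from Z ∘ (F₁ G (g B.∘ f) ∘ φ.to X)
            ≈⟨ ∘-congˡ (∘-congʳ G.homomorphism) ⟩
          φ.from Z ∘ ((F₁ G g ∘ F₁ G f) ∘ φ.to X)
            ≈⟨ ∘-congˡ assoc ⟩
          φ.from Z ∘ (F₁ G g ∘ (F₁ G f ∘ φ.to X))
            -- The identity of `F₀ G Y` is inserted as `φ.to Y ∘ φ.from Y` to split the conjugate in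
            -- two.
            ≈⟨ ∘-congˡ (∘-congˡ (cancelˡ (φ.isoʳ Y))) ⟨
          φ.from Z ∘ (F₁ G g ∘ (φ.to Y ∘ (φ.from Y ∘ (F₁ G f ∘ φ.to X))))
            ≈⟨ ∘-congˡ assoc ⟨
          φ.from Z ∘ ((F₁ G g ∘ φ.to Y) ∘ (φ.from Y ∘ (F₁ G f ∘ φ.to X)))
            ≈⟨ assoc ⟨
          (φ.from Z ∘ (F₁ G g ∘ φ.to Y)) ∘ (φ.from Y ∘ (F₁ G f ∘ φ.to X))
            ∎
      ; F-resp-≈ = λ f≈g → ∘-congˡ (∘-congʳ (G.F-resp-≈ f≈g))
      }
      where open HomReasoning

    iso : Iso [ B , C ] functor G
    iso = pointwiseIso
      (record { η = φ.to ; commute = λ {X} {Y} f → cancelˡ (φ.isoʳ Y) })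
      φ.from φ.isoˡ φ.isoʳ

-- Arrows of `Auto ι L` as triangles over `L`.

module _ (I : Category o₁ ℓ₁ e₁) (P : Category.Obj I → Set p)
         (C : Category o₂ ℓ₂ e₂) (L : Functor (FullSubcategory I P) C) where
  private
    O = FullSubcategory I P
    ι = inclusion I P
    module I = Category I
    module O = Category O
    module L = Functor L
    module Auto = Category (Auto ι L)
  open Category C
  open CategoryProperties C
  open HomReasoning
  open Equiv using () renaming (sym to ≈-sym; trans to ≈-trans)

  module Restriction (A : Auto.Obj) = Iso (≡F⇒Iso (proj₂ A))

  -- The condition `IsIdentityOn` in terms of casts; `toAuto` and `fromAuto` pass between the two
  -- forms.
  IdentityOnL : (A B : Auto.Obj) → NaturalTransformation (proj₁ A) (proj₁ B) → Set _
  IdentityOnL A B α =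
    ∀ X → η (Restriction.to B) X ∘ η α (value X) ≈ η (Restriction.to A) X

  toAuto : (A B : Auto.Obj) (α : NaturalTransformation (proj₁ A) (proj₁ B)) →
           IdentityOnL A B α → A Auto.⇒ B
  toAuto (_ , A≡) (_ , B≡) α α-id = α , λ X →
    square⇒subst₂ (eq₀ A≡ X) (eq₀ B≡ X) (≈-trans (α-id X) (≈-sym identityˡ))

  fromAuto : (A B : Auto.Obj) (α : A Auto.⇒ B) → IdentityOnL A B (proj₁ α)
  fromAuto (_ , A≡) (_ , B≡) (_ , α-id) X =
    ≈-trans (subst₂⇒square (eq₀ A≡ X) (eq₀ B≡ X) (α-id X)) identityˡ

  -- Replacing `G` by an isomorphic functor that restricts strictly to `L`.

  module Strictify (P? : Decidable P) (G : Functor I C) (ν : Iso [ O , C ] (G ∘F ι) L) where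
    private
      module ν = Iso ν

      -- The decision is an argument rather than the fixed `P? i`, so that the facts about it follow
      -- by matching on `d`.
      obj : ∀ i → Dec (P i) → Obj
      obj i (yes pi) = F₀ L (i ,ᴿ irr pi)
      obj i (no _)   = F₀ G i

      φ : ∀ i (d : Dec (P i)) → Iso C (obj i d) (F₀ G i)
      φ i (yes pi) = record
        { to   = η ν.from (i ,ᴿ irr pi) ; from = η ν.to (i ,ᴿ irr pi)
        ; isoˡ = ν.isoʳ _ ; isoʳ = ν.isoˡ _ }
      φ i (no _)   = Iso-refl

      -- Membership proofs are irrelevant, so the object of `O` rebuilt from the decided proof is
      -- `X` definitionally; this gives `refl`.
      obj-ι : ∀ X (d : Dec (P (value X))) → obj (value X) d ≡ F₀ L X
      obj-ι X             (yes _)  = refl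
      obj-ι (i ,ᴿ irr pi) (no ¬pi) = contradiction-irr pi ¬pi

      φ-ι : ∀ X (d : Dec (P (value X))) →
            η ν.to X ∘ Iso.to (φ (value X) d) ≈ cast (obj-ι X d)
      φ-ι X             (yes _)  = ν.isoʳ X
      φ-ι (i ,ᴿ irr pi) (no ¬pi) = contradiction-irr pi ¬pi

      module A = Conjugate G (λ i → φ i (P? i))

    iso : Iso [ I , C ] A.functor G
    iso = A.iso

    private
      module θ = Iso iso

      eq : ∀ X → obj (value X) (P? (value X)) ≡ F₀ L X
      eq X = obj-ι X (P? (value X))

    -- Over `O`, the isomorphism to `G` is inverse to `ν` up to the cast. Both strictness of the
    -- restriction and the universal properties below rest on this.
    iso-ι : ∀ X → η ν.to X ∘ η θ.to (value X) ≈ cast (eq X)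
    iso-ι X = φ-ι X (P? (value X))

    automaton : Auto.Obj
    automaton = A.functor , record
      { eq₀ = eq
      -- By `iso-ι` the casts are the components of a composite of two natural transformations,
      -- hence natural.
      ; eq₁ = λ {X} {Y} f → square⇒subst₂ (eq X) (eq Y) (begin
          cast (eq Y) ∘ F₁ A.functor f                    ≈⟨ ∘-congʳ (iso-ι Y) ⟨
          (η ν.to Y ∘ η θ.to (value Y)) ∘ F₁ A.functor f  ≈⟨ pullʳ (NaturalTransformation.commute θ.to f) ⟩
          η ν.to Y ∘ (F₁ G f ∘ η θ.to (value X))          ≈⟨ pullˡ (NaturalTransformation.commute ν.to {X} {Y} f) ⟩
          (F₁ L {X} {Y} f ∘ η ν.to X) ∘ η θ.to (value X)  ≈⟨ pullʳ (iso-ι X) ⟩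
          F₁ L {X} {Y} f ∘ cast (eq X)                    ∎)
      }

  -- Left Kan extension and the initial automaton.

  module _ (K : LeftKanExtension ι L) (pw : ∀ X → IsPointwiseLanAt K (F₀ ι X)) where
    open LeftKanExtension K
    private
      module Lan = Functor Lan

      -- Fullness of `ι` makes each `f : ι Y → ι X` an arrow of `O`, so `L` applies to it. The arrow
      -- that this cocone induces out of the colimit is the inverse of the unit.
      cocone-L : ∀ (X : O.Obj) → Cocone ι L (value X) (F₀ L X)
      cocone-L X = record
        { leg     = λ Y f → F₁ L {Y} {X} f
        ; natural = λ {Y} {Z} g f f′ f′g≈f →
            ≈-trans (≈-sym (L.homomorphism {Y} {Z} {X})) (L.F-resp-≈ {Y} {X} f′g≈f)
        }

      cocone-Lan : ∀ (X : O.Obj) → Cocone ι L (value X) (F₀ Lan (value X))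
      cocone-Lan X = record
        { leg     = λ Y f → F₁ Lan f ∘ η unit Y
        ; natural = λ {Y} {Z} g f f′ f′g≈f → begin
            (F₁ Lan f′ ∘ η unit Z) ∘ F₁ L g    ≈⟨ pullʳ (NaturalTransformation.commute unit g) ⟩
            F₁ Lan f′ ∘ (F₁ Lan g ∘ η unit Y)  ≈⟨ pullˡ (≈-trans (≈-sym Lan.homomorphism) (Lan.F-resp-≈ f′g≈f)) ⟩
            F₁ Lan f ∘ η unit Y                ∎
        }

      unit⁻¹ : ∀ (X : O.Obj) → F₀ Lan (value X) ⇒ F₀ L X
      unit⁻¹ X = proj₁ (pw X (cocone-L X))

      unit⁻¹-factors : ∀ X Y f → unit⁻¹ X ∘ (F₁ Lan f ∘ η unit Y) ≈ F₁ L {Y} {X} f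
      unit⁻¹-factors X = proj₁ (proj₂ (pw X (cocone-L X)))

      unit⁻¹ˡ : ∀ X → unit⁻¹ X ∘ η unit X ≈ id
      unit⁻¹ˡ X = begin
        unit⁻¹ X ∘ η unit X                    ≈⟨ ∘-congˡ identityˡ ⟨
        unit⁻¹ X ∘ (id ∘ η unit X)             ≈⟨ ∘-congˡ (∘-congʳ Lan.identity) ⟨
        unit⁻¹ X ∘ (F₁ Lan I.id ∘ η unit X)    ≈⟨ unit⁻¹-factors X X I.id ⟩
        F₁ L (O.id {X})                        ≈⟨ L.identity {X} ⟩
        id                                     ∎

      -- Both sides factor the colimit cocone `cocone-Lan X` through itself, so they agree by
      -- uniqueness.
      unit⁻¹ʳ : ∀ X → η unit X ∘ unit⁻¹ X ≈ id
      unit⁻¹ʳ X = ≈-trans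
        (unique (η unit X ∘ unit⁻¹ X) λ Y f → begin
          (η unit X ∘ unit⁻¹ X) ∘ (F₁ Lan f ∘ η unit Y)  ≈⟨ pullʳ (unit⁻¹-factors X Y f) ⟩
          η unit X ∘ F₁ L {Y} {X} f                      ≈⟨ NaturalTransformation.commute unit {Y} {X} f ⟩
          F₁ Lan f ∘ η unit Y                            ∎)
        (≈-sym (unique id λ Y f → identityˡ))
        where unique = proj₂ (proj₂ (pw X (cocone-Lan X)))

    unit-iso : Iso [ O , C ] L (Lan ∘F ι)
    unit-iso = pointwiseIso unit unit⁻¹ unit⁻¹ˡ unit⁻¹ʳ

    module _ (P? : Decidable P) where
      private
        -- The unit runs from `L` to `Lan ∘F ι`, opposite to what `Strictify` takes, hence
        -- `Iso-sym`.
        module S = Strictify P? Lan (CategoryProperties.Iso-sym [ O , C ] unit-iso)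
        module u = Iso unit-iso
        module θ = Iso S.iso
        module A = Restriction S.automaton

        unit-iso-ι : ∀ X → η unit X ∘ η A.to X ≈ η θ.to (value X)
        unit-iso-ι X = ≈-trans (∘-congˡ (≈-sym (S.iso-ι X))) (cancelˡ (u.isoʳ X))

      strictLan-initial : IsInitial (Auto ι L) S.automaton
      strictLan-initial B =
        -- `s` is the extension along the unit of the inverse casts `L → B ∘ ι`; precomposing with
        -- `θ.to` makes it start at the strict automaton.
        toAuto S.automaton B (Category._∘_ [ I , C ] s θ.to) (λ X → begin
          η B.to X ∘ (η s (value X) ∘ η θ.to (value X))            ≈⟨ ∘-congˡ (∘-congˡ (unit-iso-ι X)) ⟨
          η B.to X ∘ (η s (value X) ∘ (η unit X ∘ η A.to X))       ≈⟨ ∘-congˡ (pullˡ (σ-comm (proj₁ B) B.from X)) ⟩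
          η B.to X ∘ (η B.from X ∘ η A.to X)                       ≈⟨ cancelˡ (B.isoʳ X) ⟩
          η A.to X                                                 ∎)
        -- For uniqueness, `g` is carried back to a transformation out of `Lan` by `θ.from`, where
        -- `σ-unique` applies.
        , λ g i → begin
          η (proj₁ g) i                                ≈⟨ cancelʳ (θ.isoˡ i) ⟨
          (η (proj₁ g) i ∘ η θ.from i) ∘ η θ.to i      ≈⟨ ∘-congʳ (σ-unique (proj₁ B) B.from
                                                            (Category._∘_ [ I , C ] (proj₁ g) θ.from)
                                                            (extends g) i) ⟩
          η s i ∘ η θ.to i                             ∎
        where
        module B = Restriction B
        s = σ (proj₁ B) B.from

        -- Because `g` is the identity on `L`, the transformation `g ∘ θ.from` solves the extension
        -- problem that defines `s`.
        extends : ∀ (g : S.automaton Auto.⇒ B) X →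
                  (η (proj₁ g) (value X) ∘ η θ.from (value X)) ∘ η unit X ≈ η B.from X
        extends g X = begin
          (gX ∘ η θ.from (value X)) ∘ η unit X
            -- The identity is introduced to become `A.to ∘ A.from`, so that `unit-iso-ι` can turn
            -- the unit into `θ.to`.
            ≈⟨ ∘-congˡ identityʳ ⟨
          (gX ∘ η θ.from (value X)) ∘ (η unit X ∘ id)
            ≈⟨ ∘-congˡ (∘-congˡ (A.isoʳ X)) ⟨
          (gX ∘ η θ.from (value X)) ∘ (η unit X ∘ (η A.to X ∘ η A.from X))
            ≈⟨ ∘-congˡ (pullˡ (unit-iso-ι X)) ⟩
          (gX ∘ η θ.from (value X)) ∘ (η θ.to (value X) ∘ η A.from X)
            ≈⟨ pullʳ (cancelˡ (θ.isoˡ (value X))) ⟩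
          gX ∘ η A.from X
            ≈⟨ cancelˡ (B.isoˡ X) ⟨
          η B.from X ∘ (η B.to X ∘ (gX ∘ η A.from X))
            ≈⟨ ∘-congˡ (pullˡ (fromAuto S.automaton B g X)) ⟩
          η B.from X ∘ (η A.to X ∘ η A.from X)
            ≈⟨ ∘-congˡ (A.isoʳ X) ⟩
          η B.from X ∘ id
            ≈⟨ identityʳ ⟩
          η B.from X
            ∎
          where gX = η (proj₁ g) (value X)

      initialAutomaton : Σ[ A ∈ Auto.Obj ] IsInitial (Auto ι L) A × Iso [ I , C ] (proj₁ A) Lan
      initialAutomaton = S.automaton , strictLan-initial , S.iso

  -- Right Kan extension and the final automaton.

  module _ (K : RightKanExtension ι L) (pw : ∀ X → IsPointwiseRanAt K (F₀ ι X)) where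
    open RightKanExtension K
    private
      module Ran = Functor Ran

      -- Dually, the identity of `ι X` is initial among the arrows `ι X → ι Y`, and the arrow
      -- induced into the limit is the inverse of the counit.
      cone-L : ∀ (X : O.Obj) → Cone ι L (value X) (F₀ L X)
      cone-L X = record
        { leg     = λ Y f → F₁ L {X} {Y} f
        ; natural = λ {Y} {Z} g f f′ gf≈f′ →
            ≈-trans (≈-sym (L.homomorphism {X} {Y} {Z})) (L.F-resp-≈ {X} {Z} gf≈f′)
        }

      cone-Ran : ∀ (X : O.Obj) → Cone ι L (value X) (F₀ Ran (value X))
      cone-Ran X = record
        { leg     = λ Y f → η counit Y ∘ F₁ Ran f
        ; natural = λ {Y} {Z} g f f′ gf≈f′ → begin
            F₁ L g ∘ (η counit Y ∘ F₁ Ran f)    ≈⟨ pullˡ (≈-sym (NaturalTransformation.commute counit g)) ⟩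
            (η counit Z ∘ F₁ Ran g) ∘ F₁ Ran f  ≈⟨ pullʳ (≈-trans (≈-sym Ran.homomorphism) (Ran.F-resp-≈ gf≈f′)) ⟩
            η counit Z ∘ F₁ Ran f′              ∎
        }

      counit⁻¹ : ∀ (X : O.Obj) → F₀ L X ⇒ F₀ Ran (value X)
      counit⁻¹ X = proj₁ (pw X (cone-L X))

      counit⁻¹-factors : ∀ X Y f → (η counit Y ∘ F₁ Ran f) ∘ counit⁻¹ X ≈ F₁ L {X} {Y} f
      counit⁻¹-factors X = proj₁ (proj₂ (pw X (cone-L X)))

      counit⁻¹ʳ : ∀ X → η counit X ∘ counit⁻¹ X ≈ id
      counit⁻¹ʳ X = begin
        η counit X ∘ counit⁻¹ X                    ≈⟨ ∘-congʳ identityʳ ⟨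
        (η counit X ∘ id) ∘ counit⁻¹ X             ≈⟨ ∘-congʳ (∘-congˡ Ran.identity) ⟨
        (η counit X ∘ F₁ Ran I.id) ∘ counit⁻¹ X    ≈⟨ counit⁻¹-factors X X I.id ⟩
        F₁ L (O.id {X})                            ≈⟨ L.identity {X} ⟩
        id                                         ∎

      counit⁻¹ˡ : ∀ X → counit⁻¹ X ∘ η counit X ≈ id
      counit⁻¹ˡ X = ≈-trans
        (unique (counit⁻¹ X ∘ η counit X) λ Y f → begin
          (η counit Y ∘ F₁ Ran f) ∘ (counit⁻¹ X ∘ η counit X)  ≈⟨ pullˡ (counit⁻¹-factors X Y f) ⟩
          F₁ L {X} {Y} f ∘ η counit X                          ≈⟨ NaturalTransformation.commute counit {X} {Y} f ⟨
          η counit Y ∘ F₁ Ran f                                ∎)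
        (≈-sym (unique id λ Y f → identityʳ))
        where unique = proj₂ (proj₂ (pw X (cone-Ran X)))

    counit-iso : Iso [ O , C ] (Ran ∘F ι) L
    counit-iso = pointwiseIso counit counit⁻¹ counit⁻¹ˡ counit⁻¹ʳ

    module _ (P? : Decidable P) where
      private
        module S = Strictify P? Ran counit-iso
        module θ = Iso S.iso
        module A = Restriction S.automaton

      strictRan-terminal : IsTerminal (Auto ι L) S.automaton
      strictRan-terminal B =
        -- `s` is the transformation into `Ran` induced by the casts `B ∘ ι → L`; `θ.from` moves its
        -- target to the strict automaton.
        toAuto B S.automaton (Category._∘_ [ I , C ] θ.from s) (λ X → begin
          η A.to X ∘ (η θ.from (value X) ∘ η s (value X))
            ≈⟨ ∘-congʳ (S.iso-ι X) ⟨
          (η counit X ∘ η θ.to (value X)) ∘ (η θ.from (value X) ∘ η s (value X))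
            ≈⟨ pullʳ (cancelˡ (θ.isoʳ (value X))) ⟩
          η counit X ∘ η s (value X)
            ≈⟨ δ-comm (proj₁ B) B.to X ⟩
          η B.to X
            ∎)
        , λ g i → begin
          η (proj₁ g) i                                ≈⟨ cancelˡ (θ.isoˡ i) ⟨
          η θ.from i ∘ (η θ.to i ∘ η (proj₁ g) i)      ≈⟨ ∘-congˡ (δ-unique (proj₁ B) B.to
                                                            (Category._∘_ [ I , C ] θ.to (proj₁ g))
                                                            -- The counit already points towards
                                                            -- `L`, so `S.iso-ι` turns `counit`
                                                            -- after `θ.to` directly into the cast.
                                                            (λ X → ≈-trans (pullˡ (S.iso-ι X))
                                                                           (fromAuto B S.automaton g X)) i) ⟩
          η θ.from i ∘ η s i                           ∎
        where
        module B = Restriction B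
        s = δ (proj₁ B) B.to

      finalAutomaton : Σ[ A ∈ Auto.Obj ] IsTerminal (Auto ι L) A × Iso [ I , C ] (proj₁ A) Ran
      finalAutomaton = S.automaton , strictRan-terminal , S.iso

lemma2p9 : {o ℓ e p o′ ℓ′ e′ : Level}
    (I : Category o ℓ e) (P : Category.Obj I → Set p) → Decidable P →
    (C : Category o′ ℓ′ e′) (L : Functor (FullSubcategory I P) C) →
    let ι = inclusion I P in
    ((K : LeftKanExtension ι L) → (∀ X → IsPointwiseLanAt K (F₀ ι X)) →
    Σ[ A-init ∈ Category.Obj (Auto ι L) ]
    IsInitial (Auto ι L) A-init
    × Iso [ I , C ] (proj₁ A-init) (LeftKanExtension.Lan K))
    ×
    ((K : RightKanExtension ι L) → (∀ X → IsPointwiseRanAt K (F₀ ι X)) →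
    Σ[ A-final ∈ Category.Obj (Auto ι L) ]
    IsTerminal (Auto ι L) A-final
    × Iso [ I , C ] (proj₁ A-final) (RightKanExtension.Ran K))
lemma2p9 I P P? C L =
  (λ K pw → initialAutomaton I P C L K pw P?) ,
  (λ K pw → finalAutomaton I P C L K pw P?)
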